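{- Every $n$-node directed graph $G=(V,E)$ and every set $P \subseteq V \times V$ of node pairs has a reachability preserver on $O\left(n + (n|P|)^{2/3}\right)$ edges.
   Context: For a directed graph $G=(V,E)$ and a set of node pairs $P \subseteq V \times V$, a reachability preserver of $G,P$ is a subgraph $H=(V,E')$ with $E' \subseteq E$ such that for all $(s,t) \in P$, $H$ contains a directed path from $s$ to $t$ if and only if $G$ does. -}

module Defs where

open import Data.Nat using (ℕ)
open import Data.Fin using (Fin)
open import Data.Product using (_×_; _,_)
open import Data.List using (List)
open import Data.List.Membership.Propositional using (_∈_)
open import Function.Bundles using (_⇔_)

Graph : ℕ → Set
Graph n = List (Fin n × Fin n)

data Reach {n : ℕ} (E : Graph n) : Fin n → Fin n → Set where
  here : ∀ {s} → Reach E s s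
  step : ∀ {s u t} → (s , u) ∈ E → Reach E u t → Reach E s t

Subgraph : ∀ {n} → Graph n → Graph n → Set
Subgraph E′ E = ∀ {e} → e ∈ E′ → e ∈ E

IsReachabilityPreserver : ∀ {n} → Graph n → List (Fin n × Fin n) → Graph n → Set
IsReachabilityPreserver E P E′ =
  Subgraph E′ E ×
  (∀ {s t} → (s , t) ∈ P → (Reach E′ s t ⇔ Reach E s t))

{-# OPTIONS --safe #-}

-- Keep a graph T of at most 2n edges that preserves the strong components, and
-- prune the other edges to a minimal set F such that F ++ T is a preserver.
-- Each edge of F is then unavoidable for some pair, which we charge with it;
-- along a pair its edges are linearly ordered.  Identify the tails of these
-- edges when they lie in the same strong component.  Two different ways to get
-- from one tail to another would let a pair bypass one of its unavoidable
-- edges; so if i, j have the same tail and k follows j on the same pair, then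
-- (i , j , k) is determined by the pair of i and the tail of k, and there are
-- at most n |P| such triples.  But after discarding n δ + |P| κ edges, each
-- remaining j lies in δ κ triples; take δ ≈ |F| / 4n and κ ≈ |F| / 4|P|.
module Submission where

open import Defs
open import Data.Fin as Fin using (Fin; zero; suc; fromℕ<; combine; remQuot; inject≤)
import Data.Fin.Properties as Finₚ
open import Data.List using (List; []; _∷_; _++_; length; lookup; map; filter; allFin; deduplicate)
open import Data.List.Properties using (length-++; length-map; length-tabulate; filter-≐)
open import Data.List.Membership.Propositional using (_∈_; find)
open import Data.List.Membership.Propositional.Properties
  using (∈-++⁺ˡ; ∈-++⁺ʳ; ∈-++⁻; ∈-filter⁺; ∈-filter⁻; ∈-map⁺; ∈-map⁻; ∈-lookup; ∈-allFin;
         ∈-deduplicate⁺; ∈-deduplicate⁻)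
open import Data.List.Relation.Unary.All as All using (All; []; _∷_; all?)
open import Data.List.Relation.Unary.All.Properties using (¬All⇒Any¬; ¬Any⇒All¬)
open import Data.List.Relation.Unary.AllPairs using (_∷_)
open import Data.List.Relation.Unary.Any as Any using (Any; here; there; any?; index)
open import Data.List.Relation.Unary.Any.Properties using (lookup-index)
import Data.List.Relation.Unary.Unique.DecPropositional.Properties as DecUnique
open import Data.List.Relation.Unary.Unique.Propositional using (Unique)
open import Data.List.Relation.Unary.Unique.Propositional.Properties using (filter⁺; allFin⁺)
open import Data.Nat as ℕ using (ℕ; zero; suc; _+_; _*_; _^_; _≤_; _<_; z≤n; s≤s)
open import Data.Nat.DivMod using (_/_; _%_; m≡m%n+[m/n]*n; m%n<n; m≥n⇒m/n>0; m/n*n≤m)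
open import Data.Nat.Properties as ℕₚ using (≤-trans; ≤-reflexive; +-suc; <⇒≢; <-irrefl; n≤1+n)
open import Data.Nat.Tactic.RingSolver using (solve-∀)
open import Data.Product using (_×_; ∃-syntax; _,_; proj₁; proj₂; swap)
open import Data.Product.Properties using (≡-dec)
open import Data.Sum using (_⊎_; inj₁; inj₂; [_,_]′)
open import Function using (_∘_; id; mk⇔)
import Relation.Binary as B
open import Relation.Binary.Definitions using (tri<; tri≈; tri>)
open import Relation.Binary.PropositionalEquality
  using (_≡_; _≢_; refl; sym; trans; cong; cong₂; subst)
open import Relation.Nullary using (yes; no; ¬_; ¬?; contradiction)
open import Relation.Nullary.Decidable using (map′; _×-dec_; _⊎-dec_; _→-dec_)
import Relation.Unary as U

private variable
  n : ℕ
  E E′ : Graph n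
  s t u v : Fin n

Edge : ℕ → Set
Edge n = Fin n × Fin n

_≟ᵉ_ : B.DecidableEquality (Edge n)
_≟ᵉ_ = ≡-dec Finₚ._≟_ Finₚ._≟_

-- Reachability

Reach-trans : Reach E s t → Reach E t u → Reach E s u
Reach-trans here q = q
Reach-trans (step e p) q = step e (Reach-trans p q)

Reach-mono : Subgraph E E′ → Reach E s t → Reach E′ s t
Reach-mono sub here = here
Reach-mono sub (step e p) = step (sub e) (Reach-mono sub p)

edge : (s , t) ∈ E → Reach E s t
edge e = step e here

Reach-swap : Reach E s t → Reach (map swap E) t s
Reach-swap here = here
Reach-swap (step e p) = Reach-trans (Reach-swap p) (edge (∈-map⁺ swap e))

-- The two parts of the second alternative come from the first and the last
-- passage of the walk through (u , v).
Reach-split : Subgraph E ((u , v) ∷ E′) → Reach E s t →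
              Reach E′ s t ⊎ (Reach E′ s u × Reach E′ v t)
Reach-split sub here = inj₁ here
Reach-split sub (step e p) with sub e | Reach-split sub p
... | here refl | inj₁ q       = inj₂ (here , q)
... | here refl | inj₂ (_ , q) = inj₂ (here , q)
... | there e′  | inj₁ q       = inj₁ (step e′ q)
... | there e′  | inj₂ (q , r) = inj₂ (step e′ q , r)

-- A walk avoids the head edge or splits around it, so recursion on the edge list decides
-- reachability without a bound on the length of walks.
reach? : (E : Graph n) → B.Decidable (Reach E)
reach? [] s t = map′ (λ { refl → here }) (λ { here → refl }) (s Finₚ.≟ t)
reach? ((u , v) ∷ E) s t =
  map′ [ Reach-mono there
       , (λ (p , q) → Reach-trans (Reach-mono there p) (step (here refl) (Reach-mono there q))) ]′
       (Reach-split id)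
       (reach? E s t ⊎-dec (reach? E s u ×-dec reach? E v t))

-- Cardinalities of lists without repetition

module _ {A : Set} where

  lookup-injective : {xs : List A} → Unique xs → ∀ i j → lookup xs i ≡ lookup xs j → i ≡ j
  lookup-injective (_ ∷ _) zero zero _ = refl
  lookup-injective {x ∷ xs} (x∉ ∷ _) zero (suc j) eq =
    contradiction eq (All.lookup x∉ (∈-lookup j))
  lookup-injective {x ∷ xs} (x∉ ∷ _) (suc i) zero eq =
    contradiction (sym eq) (All.lookup x∉ (∈-lookup i))
  lookup-injective (_ ∷ uxs) (suc i) (suc j) eq = cong suc (lookup-injective uxs i j eq)

  Unique-⊆-length : {xs ys : List A} → Unique xs → (∀ {x} → x ∈ xs → x ∈ ys) →
                    length xs ≤ length ys
  Unique-⊆-length {xs} {ys} uxs sub = Finₚ.injective⇒≤ {f = pos} pos-injective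
    where
    pos : Fin (length xs) → Fin (length ys)
    pos i = index (sub (∈-lookup i))
    pos-injective : ∀ {i j} → pos i ≡ pos j → i ≡ j
    pos-injective {i} {j} eq = lookup-injective uxs i j
      (trans (lookup-index (sub (∈-lookup i)))
             (trans (cong (lookup ys) eq) (sym (lookup-index (sub (∈-lookup j))))))

  length≤filter+filter : {P Q : A → Set} (P? : U.Decidable P) (Q? : U.Decidable Q) →
                         (∀ x → P x ⊎ Q x) → (xs : List A) →
                         length xs ≤ length (filter P? xs) + length (filter Q? xs)
  length≤filter+filter P? Q? PQ [] = z≤n
  length≤filter+filter P? Q? PQ (x ∷ xs) with length≤filter+filter P? Q? PQ xs | P? x | Q? x
  ... | le | yes _  | yes _  = s≤s (≤-trans le (ℕₚ.+-monoʳ-≤ (length (filter P? xs)) (n≤1+n _)))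
  ... | le | yes _  | no _   = s≤s le
  ... | le | no _   | yes _  = ≤-trans (s≤s le) (≤-reflexive (sym (+-suc _ _)))
  ... | le | no ¬Px | no ¬Qx = contradiction (PQ x) [ ¬Px , ¬Qx ]′

Unique⇒length≤n : {xs : List (Fin n)} → Unique xs → length xs ≤ n
Unique⇒length≤n {n} uxs =
  ≤-trans (Unique-⊆-length uxs (λ {x} _ → ∈-allFin x)) (≤-reflexive (length-tabulate {n = n} id))

Unique⇒length≤n*n : {P : List (Edge n)} → Unique P → length P ≤ n * n
Unique⇒length≤n*n {n} {P} uP = Finₚ.injective⇒≤ {f = code} code-injective
  where
  code : Fin (length P) → Fin (n * n)
  code i = combine (proj₁ (lookup P i)) (proj₂ (lookup P i))
  code-injective : ∀ {i j} → code i ≡ code j → i ≡ j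
  code-injective {i} {j} eq with Finₚ.combine-injective _ _ _ _ eq
  ... | eq₁ , eq₂ = lookup-injective uP i j (cong₂ _,_ eq₁ eq₂)

-- Sparse subgraphs that keep the strongly connected components

-- Greedy search from `R`: as long as an edge leaves `R`, it joins `T` and its head joins `R`. Each
-- round spends one unit of fuel and adds one vertex, so the fuel suffices. The root `r′` from which
-- `T` reaches `v` may differ from `r`.
forest : (E : Graph n) (fuel : ℕ) (R : List (Fin n)) → Unique R → n ≤ fuel + length R →
         ∃[ T ] (Subgraph T E × length T ≤ fuel ×
                 (∀ {r v} → r ∈ R → Reach E r v → ∃[ r′ ] (r′ ∈ R × Reach T r′ v)))
forest {n} E fuel R uR n≤
  with any? (λ (u , v) → any? (u Finₚ.≟_) R ×-dec ¬? (any? (v Finₚ.≟_) R)) E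
... | no closed = [] , (λ ()) , z≤n , λ r∈R p → _ , stay r∈R p , here
  where
  stay : ∀ {r v} → r ∈ R → Reach E r v → v ∈ R
  stay r∈R here = r∈R
  stay r∈R (step {u = u} e p) with any? (u Finₚ.≟_) R
  ... | yes u∈R = stay u∈R p
  ... | no u∉R = contradiction (Any.map (λ { refl → r∈R , u∉R }) e) closed
... | yes found with find found
... | (u , v) , uv∈E , u∈R , v∉R = grow fuel n≤
  where
  uvR : Unique (v ∷ R)
  uvR = ¬Any⇒All¬ R v∉R ∷ uR
  grow : (fuel : ℕ) → n ≤ fuel + length R →
         ∃[ T ] (Subgraph T E × length T ≤ fuel ×
                 (∀ {r v} → r ∈ R → Reach E r v → ∃[ r′ ] (r′ ∈ R × Reach T r′ v)))
  grow zero n≤ = contradiction (≤-trans (Unique⇒length≤n uvR) n≤) (<-irrefl refl)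
  grow (suc fuel) n≤ with forest E fuel (v ∷ R) uvR (≤-trans n≤ (≤-reflexive (sym (+-suc fuel _))))
  ... | T , T⊆E , len , cover =
    (u , v) ∷ T , (λ { (here refl) → uv∈E ; (there e) → T⊆E e }) , s≤s len , cover′
    where
    cover′ : ∀ {r w} → r ∈ R → Reach E r w → ∃[ r′ ] (r′ ∈ R × Reach ((u , v) ∷ T) r′ w)
    cover′ r∈R p with cover (there r∈R) p
    -- `v` is a root only in the recursive call; here it is reached from `u` by the new edge.
    ... | _ , here refl , q = u , u∈R , step (here refl) (Reach-mono there q)
    ... | r′ , there r′∈R , q = r′ , r′∈R , Reach-mono there q

first : {A : Set} → A → List A → A
first d [] = d
first d (x ∷ _) = x

first∈ : {A : Set} {d x : A} {xs : List A} → x ∈ xs → first d xs ∈ xs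
first∈ {xs = _ ∷ _} _ = here refl

first-default : {A : Set} {d d′ x : A} {xs : List A} → x ∈ xs → first d xs ≡ first d′ xs
first-default {xs = _ ∷ _} _ = refl

module StrongComponents {n : ℕ} (E : Graph n) where

  _∼_ : Fin n → Fin n → Set
  u ∼ v = Reach E u v × Reach E v u

  ∼-refl : ∀ {u} → u ∼ u
  ∼-refl = here , here

  ∼-sym : ∀ {u v} → u ∼ v → v ∼ u
  ∼-sym (p , q) = q , p

  ∼-trans : ∀ {u v w} → u ∼ v → v ∼ w → u ∼ w
  ∼-trans (p , q) (p′ , q′) = Reach-trans p p′ , Reach-trans q′ q

  _∼?_ : B.Decidable _∼_
  u ∼? v = reach? E u v ×-dec reach? E v u

  component : Fin n → List (Fin n)
  component v = filter (v ∼?_) (allFin n)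

  v∈component : ∀ v → v ∈ component v
  v∈component v = ∈-filter⁺ (v ∼?_) (∈-allFin v) ∼-refl

  -- Filtering one fixed enumeration makes equivalent vertices choose the same representative.
  rep : Fin n → Fin n
  rep v = first v (component v)

  ∼rep : ∀ v → v ∼ rep v
  ∼rep v = proj₂ (∈-filter⁻ (v ∼?_) {xs = allFin n} (first∈ (v∈component v)))

  rep-cong : ∀ {u v} → u ∼ v → rep u ≡ rep v
  rep-cong {u} {v} u∼v = trans (cong (first u) same) (first-default (v∈component v))
    where
    same : component u ≡ component v
    same = filter-≐ (u ∼?_) (v ∼?_)
             (∼-trans (∼-sym u∼v) , ∼-trans u∼v) (allFin n)

  inner : Graph n
  inner = filter (λ (u , v) → reach? E v u) E

  inner⇒∼ : ∀ {u v} → Reach inner u v → u ∼ v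
  inner⇒∼ here = ∼-refl
  inner⇒∼ (step e p) with ∈-filter⁻ (λ (u , v) → reach? E v u) {xs = E} e
  ... | e′ , back = ∼-trans (edge e′ , back) (inner⇒∼ p)

  -- From the head of each edge, the rest of the walk followed by the way back returns to its tail,
  -- so the edge lies in `inner`.
  ∼⇒inner : ∀ {u v} → u ∼ v → Reach inner u v
  ∼⇒inner (p , q) = go p q
    where
    go : ∀ {u v} → Reach E u v → Reach E v u → Reach inner u v
    go here q = here
    go (step e p) q =
      step (∈-filter⁺ (λ (u , v) → reach? E v u) e (Reach-trans p q)) (go p (Reach-trans q (edge e)))

  roots : List (Fin n)
  roots = filter (λ v → rep v Finₚ.≟ v) (allFin n)

  rep∈roots : ∀ v → rep v ∈ roots
  rep∈roots v = ∈-filter⁺ (λ v → rep v Finₚ.≟ v) (∈-allFin (rep v)) (sym (rep-cong (∼rep v)))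

  -- `D` will be `inner` or its reverse, which yields out-trees and in-trees. `D` never leaves a
  -- component and `roots` has one vertex in each, so the root that reaches `v` must be `rep v`.
  spanning : (D : Graph n) →
             (∀ {u v} → Reach D u v → u ∼ v) → (∀ {u v} → u ∼ v → Reach D u v) →
             ∃[ T ] (Subgraph T D × length T ≤ n × (∀ v → Reach T (rep v) v))
  spanning D D⇒∼ ∼⇒D
    with forest D n roots (filter⁺ (λ v → rep v Finₚ.≟ v) (allFin⁺ n)) (ℕₚ.m≤m+n n _)
  ... | T , T⊆D , len , cover = T , T⊆D , len , reached
    where
    reached : ∀ v → Reach T (rep v) v
    reached v with cover (rep∈roots v) (∼⇒D (∼-sym (∼rep v)))
    ... | r , r∈roots , p = subst (λ r → Reach T r v) r≡rep p
      where
      r≡rep : r ≡ rep v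
      r≡rep = trans (sym (proj₂ (∈-filter⁻ (λ v → rep v Finₚ.≟ v) {xs = allFin n} r∈roots)))
                    (rep-cong (D⇒∼ (Reach-mono T⊆D p)))

  swap-inner : ∀ {u v} → Reach (map swap inner) u v → Reach inner v u
  swap-inner p = Reach-mono unswap (Reach-swap p)
    where
    unswap : Subgraph (map swap (map swap inner)) inner
    unswap e with ∈-map⁻ swap e
    ... | _ , e′ , refl with ∈-map⁻ swap e′
    ... | _ , e″ , refl = e″

  -- In-trees lead from `u` to its representative and out-trees from there to `v`; each family has
  -- at most `n` edges.
  skeleton : ∃[ T ] (Subgraph T E × length T ≤ n + n × (∀ {u v} → rep u ≡ rep v → Reach T u v))
  skeleton
    with spanning inner inner⇒∼ ∼⇒inner
       | spanning (map swap inner) (∼-sym ∘ inner⇒∼ ∘ swap-inner) (Reach-swap ∘ ∼⇒inner ∘ ∼-sym)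
  ... | T₁ , T₁⊆ , len₁ , out | T₂ , T₂⊆ , len₂ , into =
    T₁ ++ map swap T₂ , T⊆E ,
    ≤-trans (≤-reflexive (trans (length-++ T₁) (cong (length T₁ +_) (length-map swap T₂))))
            (ℕₚ.+-mono-≤ len₁ len₂) ,
    connect
    where
    inner⊆E : Subgraph inner E
    inner⊆E e = proj₁ (∈-filter⁻ (λ (u , v) → reach? E v u) {xs = E} e)
    T⊆E : Subgraph (T₁ ++ map swap T₂) E
    T⊆E e with ∈-++⁻ T₁ e
    ... | inj₁ e₁ = inner⊆E (T₁⊆ e₁)
    ... | inj₂ e₂ with ∈-map⁻ swap e₂
    ... | _ , e₃ , refl with ∈-map⁻ swap (T₂⊆ e₃)
    ... | _ , e₄ , refl = inner⊆E e₄
    connect : ∀ {u v} → rep u ≡ rep v → Reach (T₁ ++ map swap T₂) u v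
    connect {u} {v} eq = Reach-trans
      (Reach-mono (∈-++⁺ʳ T₁) (Reach-swap (into u)))
      (subst (λ r → Reach _ r v) (sym eq) (Reach-mono ∈-++⁺ˡ (out v)))

-- Minimal preservers containing a given graph

_∖_ : Graph n → Edge n → Graph n
F ∖ e = filter (λ f → ¬? (f ≟ᵉ e)) F

∖-⊆ : (F : Graph n) (e : Edge n) → Subgraph (F ∖ e) F
∖-⊆ F e f∈ = proj₁ (∈-filter⁻ (λ f → ¬? (f ≟ᵉ e)) {xs = F} f∈)

∖-∉ : (F : Graph n) (e : Edge n) → ¬ (e ∈ F ∖ e)
∖-∉ F e e∈ = proj₂ (∈-filter⁻ (λ f → ¬? (f ≟ᵉ e)) {xs = F} e∈) refl

∖-∈ : {F : Graph n} {e f : Edge n} → f ∈ F → f ≢ e → f ∈ F ∖ e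
∖-∈ {e = e} f∈ f≢e = ∈-filter⁺ (λ f → ¬? (f ≟ᵉ e)) f∈ f≢e

∖-mono : {F F′ : Graph n} (e : Edge n) → Subgraph F F′ → Subgraph (F ∖ e) (F′ ∖ e)
∖-mono {F = F} e sub f∈ with ∈-filter⁻ (λ f → ¬? (f ≟ᵉ e)) {xs = F} f∈
... | f∈F , f≢e = ∖-∈ (sub f∈F) f≢e

++-monoˡ : {F F′ : Graph n} (T : Graph n) → Subgraph F F′ → Subgraph (F ++ T) (F′ ++ T)
++-monoˡ {F = F} {F′} T sub e with ∈-++⁻ F e
... | inj₁ e∈F = ∈-++⁺ˡ (sub e∈F)
... | inj₂ e∈T = ∈-++⁺ʳ F′ e∈T

module Pruning {n : ℕ} (E : Graph n) (P : List (Edge n)) (T : Graph n) where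

  Keeps : Graph n → Edge n → Set
  Keeps X (s , t) = Reach E s t → Reach X s t

  keeps? : (X : Graph n) → U.Decidable (Keeps X)
  keeps? X (s , t) = reach? E s t →-dec reach? X s t

  Essential : Graph n → Edge n → Set
  Essential F e = Any (λ (s , t) → Reach (F ++ T) s t × ¬ Reach ((F ∖ e) ++ T) s t) P

  -- One greedy pass is enough: an edge whose removal breaks a pair stays essential after later
  -- deletions, because fewer edges cannot restore the pair.
  prune : (D F : Graph n) → Unique F → All (Keeps (F ++ T)) P →
          ∃[ F′ ] (Subgraph F′ F × Unique F′ × All (Keeps (F′ ++ T)) P ×
                   (∀ {e} → e ∈ D → e ∈ F′ → Essential F′ e))
  prune [] F uF keep = F , id , uF , keep , λ ()
  prune (d ∷ D) F uF keep with all? (keeps? ((F ∖ d) ++ T)) P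
  ... | yes keep′ with prune D (F ∖ d) (filter⁺ (λ f → ¬? (f ≟ᵉ d)) uF) keep′
  ...   | F′ , F′⊆ , uF′ , keepF′ , ess =
    F′ , ∖-⊆ F d ∘ F′⊆ , uF′ , keepF′ ,
    λ { (here refl) e∈ → contradiction (F′⊆ e∈) (∖-∉ F d) ; (there e∈D) e∈ → ess e∈D e∈ }
  prune (d ∷ D) F uF keep | no ¬keep with prune D F uF keep
  ...   | F′ , F′⊆ , uF′ , keepF′ , ess =
    F′ , F′⊆ , uF′ , keepF′ , λ { (here refl) _ → essential ; (there e∈D) e∈ → ess e∈D e∈ }
    where
    essential : Essential F′ d
    essential with find (¬All⇒Any¬ (keeps? ((F ∖ d) ++ T)) P ¬keep)
    ... | (s , t) , st∈P , ¬kept = Any.map at st∈P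
      where
      at : ∀ {p} → (s , t) ≡ p → Reach (F′ ++ T) (proj₁ p) (proj₂ p) ×
                                 ¬ Reach ((F′ ∖ d) ++ T) (proj₁ p) (proj₂ p)
      -- `Keeps` can fail only if `E` joins the pair, and then the final preserver joins it too.
      at refl with reach? E s t
      ... | yes p = All.lookup keepF′ st∈P p ,
                    λ q → ¬kept (λ _ → Reach-mono (++-monoˡ T (∖-mono d F′⊆)) q)
      ... | no ¬p = contradiction (λ p → contradiction p ¬p) ¬kept

-- Essential edges and their order along the charged pairs

module EssentialEdges {n : ℕ} (E : Graph n) (P : List (Edge n)) (T F : Graph n) (rep : Fin n → Fin n)
  (connect : ∀ {u v} → rep u ≡ rep v → Reach T u v)
  (collapse : ∀ {u v} → Reach (F ++ T) u v → Reach (F ++ T) v u → Reach T u v)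
  (uF : Unique F)
  (essential : ∀ {e} → e ∈ F → Pruning.Essential E P T F e)
  where

  G : Graph n
  G = F ++ T

  L : ℕ
  L = length F

  tl hd : Fin L → Fin n
  tl i = proj₁ (lookup F i)
  hd i = proj₂ (lookup F i)

  without : Fin L → Graph n
  without i = (F ∖ lookup F i) ++ T

  -- The pair charged with edge `i`: `G` joins it, but no longer does once that edge is removed.
  q : Fin L → Fin (length P)
  q i = index (essential (∈-lookup i))

  c : Fin L → Fin n
  c i = rep (tl i)

  src tgt : Fin (length P) → Fin n
  src k = proj₁ (lookup P k)
  tgt k = proj₂ (lookup P k)

  T⊆G : ∀ {u v} → Reach T u v → Reach G u v
  T⊆G = Reach-mono (∈-++⁺ʳ F)

  T⊆without : ∀ {u v} i → Reach T u v → Reach (without i) u v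
  T⊆without i = Reach-mono (∈-++⁺ʳ (F ∖ lookup F i))

  without⊆G : ∀ {u v} i → Reach (without i) u v → Reach G u v
  without⊆G i = Reach-mono (++-monoˡ T (∖-⊆ F (lookup F i)))

  G-edge : ∀ i → Reach G (tl i) (hd i)
  G-edge i = edge (∈-++⁺ˡ (∈-lookup {xs = F} i))

  without-edge : ∀ {i j} → i ≢ j → Reach (without j) (tl i) (hd i)
  without-edge {i} {j} i≢j =
    edge (∈-++⁺ˡ (∖-∈ (∈-lookup {xs = F} i) (i≢j ∘ lookup-injective uF i j)))

  split : ∀ {s t} i → Reach G s t →
          Reach (without i) s t ⊎ (Reach (without i) s (tl i) × Reach (without i) (hd i) t)
  split i = Reach-split G⊆
    where
    G⊆ : Subgraph G (lookup F i ∷ without i)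
    G⊆ {f} e with ∈-++⁻ F e
    ... | inj₂ e∈T = there (∈-++⁺ʳ (F ∖ lookup F i) e∈T)
    ... | inj₁ e∈F with f ≟ᵉ lookup F i
    ... | yes refl = here refl
    ... | no f≢ = there (∈-++⁺ˡ (∖-∈ e∈F f≢))

  connected : ∀ i → Reach G (src (q i)) (tgt (q i))
  connected i = proj₁ (lookup-index (essential (∈-lookup i)))

  unavoidable : ∀ i → ¬ Reach (without i) (src (q i)) (tgt (q i))
  unavoidable i = proj₂ (lookup-index (essential (∈-lookup i)))

  before-after : ∀ i → Reach (without i) (src (q i)) (tl i) × Reach (without i) (hd i) (tgt (q i))
  before-after i with split i (connected i)
  ... | inj₁ p = contradiction p (unavoidable i)
  ... | inj₂ pq = pq

  -- A return would put both ends of edge `i` in one strong component. By `collapse`, `T` would then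
  -- link them without that edge, and the charged pair could bypass it.
  no-return : ∀ i → ¬ Reach G (hd i) (tl i)
  no-return i p with before-after i
  ... | before , after = unavoidable i
    (Reach-trans before (Reach-trans (T⊆without i (collapse (G-edge i) p)) after))

  -- Precedence is reachability in `G` rather than position on a chosen path, so it is transitive
  -- across different pairs; `no-return` is its irreflexivity.
  _⊏_ : Fin L → Fin L → Set
  i ⊏ j = Reach G (hd i) (tl j)

  _⊏?_ : B.Decidable _⊏_
  i ⊏? j = reach? G (hd i) (tl j)

  ⊏-trans : ∀ {i j k} → i ⊏ j → j ⊏ k → i ⊏ k
  ⊏-trans {j = j} p r = Reach-trans p (Reach-trans (G-edge j) r)

  -- The common pair has a walk through `i`; as `j` is unavoidable, it lies on that walk, before or
  -- after `i`.
  ⊏-total : ∀ {i j} → i ≢ j → q i ≡ q j → i ⊏ j ⊎ j ⊏ i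
  ⊏-total {i} {j} i≢j qi≡qj with before-after i
  ... | before , after with split j (without⊆G i before) | split j (without⊆G i after)
  ... | inj₂ (_ , p) | _            = inj₂ (without⊆G j p)
  ... | inj₁ _       | inj₂ (p , _) = inj₁ (without⊆G j p)
  ... | inj₁ p       | inj₁ r       = contradiction
    (subst (λ k → Reach (without j) (src k) (tgt k)) qi≡qj
           (Reach-trans p (Reach-trans (without-edge i≢j) r)))
    (unavoidable j)

  same-class⇒¬⊏ : ∀ {i j} → c i ≡ c j → ¬ i ⊏ j
  same-class⇒¬⊏ {i} ci≡cj p = no-return i (Reach-trans p (T⊆G (connect (sym ci≡cj))))

  -- The pair could reach the tail of `j`, take the detour to the tail of `k` and go on through `k`;
  -- this last stretch avoids `j`, or else there would be a return to `j`. The detour to be excluded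
  -- crosses another edge that leaves the class of `j`.
  no-detour : ∀ {j k} → q j ≡ q k → j ⊏ k → ¬ Reach (without j) (tl j) (tl k)
  no-detour {j} {k} qj≡qk j⊏k p
    with split j (Reach-trans (G-edge k) (without⊆G k (proj₂ (before-after k))))
  ... | inj₂ (r , _) = no-return j (Reach-trans j⊏k (without⊆G j r))
  ... | inj₁ r = unavoidable j
    (Reach-trans (proj₁ (before-after j))
      (Reach-trans p (subst (λ k′ → Reach (without j) (tl k) (tgt k′)) (sym qj≡qk) r)))

  -- The path system of the pairs q, read modulo strong components, has no bridge.
  no-bridge : ∀ {i j k} → i ≢ j → c i ≡ c j → q j ≡ q k → j ⊏ k → ¬ i ⊏ k
  no-bridge {i} {j} {k} i≢j ci≡cj qj≡qk j⊏k p with split j p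
  ... | inj₂ (r , _) = same-class⇒¬⊏ ci≡cj (without⊆G j r)
  ... | inj₁ r = no-detour qj≡qk j⊏k
    (Reach-trans (T⊆without j (connect (sym ci≡cj))) (Reach-trans (without-edge i≢j) r))

  Triple : Fin L → Fin L → Fin L → Set
  Triple i j k = i ≢ j × c i ≡ c j × q j ≡ q k × j ⊏ k

  ⊏-respʳ : ∀ {j k k′} → c k ≡ c k′ → j ⊏ k → j ⊏ k′
  ⊏-respʳ ck≡ p = Reach-trans p (T⊆G (connect ck≡))

  reach-tl : ∀ {i j k} → c i ≡ c j → j ⊏ k → Reach G (tl i) (tl k)
  reach-tl {j = j} ci≡cj p = Reach-trans (T⊆G (connect ci≡cj)) (Reach-trans (G-edge j) p)

  -- Otherwise `i` would lead on through `j′` to the tail of `k′`, hence to that of `k`, and `i ⊏ k`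
  -- is what `no-bridge` excludes.
  triple-first : ∀ {i j k i′ j′ k′} → Triple i j k → Triple i′ j′ k′ →
                 q i ≡ q i′ → c k ≡ c k′ → ¬ i ⊏ i′
  triple-first (i≢j , ci≡cj , qj≡qk , j⊏k) (_ , ci′≡cj′ , _ , j′⊏k′) qi≡ ck≡ i⊏i′ =
    no-bridge i≢j ci≡cj qj≡qk j⊏k
      (Reach-trans i⊏i′ (reach-tl ci′≡cj′ (⊏-respʳ (sym ck≡) j′⊏k′)))

  -- The entries are recovered in turn. `i` and `i′` share a pair, so if distinct they are
  -- comparable, and `triple-first` excludes both orders. A different `j′` would be in the class of
  -- `j` and precede `k`, which is a bridge. Finally `k` and `k′` lie on one pair, where distinct
  -- edges cannot have the same tail class.
  triple-injective : ∀ {i j k i′ j′ k′} → Triple i j k → Triple i′ j′ k′ →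
                     q i ≡ q i′ → c k ≡ c k′ → i ≡ i′ × j ≡ j′ × k ≡ k′
  triple-injective {i} {j} {k} {i′} {j′} {k′}
    t@(_ , ci≡cj , qj≡qk , j⊏k) t′@(_ , ci′≡cj′ , qj′≡qk′ , j′⊏k′) qi≡ ck≡ =
    i≡i′ , j≡j′ , k≡k′
    where
    i≡i′ : i ≡ i′
    i≡i′ with i Finₚ.≟ i′
    ... | yes eq = eq
    ... | no i≢ with ⊏-total i≢ qi≡
    ... | inj₁ p = contradiction p (triple-first t t′ qi≡ ck≡)
    ... | inj₂ p = contradiction p (triple-first t′ t (sym qi≡) (sym ck≡))
    j≡j′ : j ≡ j′
    j≡j′ with j Finₚ.≟ j′
    ... | yes eq = eq
    ... | no j≢ = contradiction (⊏-respʳ (sym ck≡) j′⊏k′)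
      (no-bridge (j≢ ∘ sym) (trans (sym ci′≡cj′) (trans (cong c (sym i≡i′)) ci≡cj)) qj≡qk j⊏k)
    k≡k′ : k ≡ k′
    k≡k′ with k Finₚ.≟ k′
    ... | yes eq = eq
    ... | no k≢ with ⊏-total k≢ (trans (sym qj≡qk) (trans (cong q j≡j′) qj′≡qk′))
    ... | inj₁ p = contradiction p (same-class⇒¬⊏ ck≡)
    ... | inj₂ p = contradiction p (same-class⇒¬⊏ (sym ck≡))

-- Ranks and double counting

module Rank {L m : ℕ} (f : Fin L → Fin m) {R : Fin L → Fin L → Set} (R? : B.Decidable R)
  (R-irrefl : ∀ {i} → ¬ R i i)
  (R-trans : ∀ {i j k} → R i j → R j k → R i k)
  (R-total : ∀ {i j} → i ≢ j → f i ≡ f j → R i j ⊎ R j i)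
  where

  Above : Fin L → Fin L → Set
  Above j k = f j ≡ f k × R j k

  above? : B.Decidable Above
  above? j k = (f j Finₚ.≟ f k) ×-dec R? j k

  above : Fin L → List (Fin L)
  above j = filter (above? j) (allFin L)

  -- The position within a fibre of `f`, counted down from the top element, which has rank 0.
  rank : Fin L → ℕ
  rank j = length (above j)

  ∈-above : ∀ {j k} → Above j k → k ∈ above j
  ∈-above {j} {k} = ∈-filter⁺ (above? j) (∈-allFin k)

  above-∈ : ∀ {j k} → k ∈ above j → Above j k
  above-∈ {j} k∈ = proj₂ (∈-filter⁻ (above? j) {xs = allFin L} k∈)

  above-unique : ∀ j → Unique (above j)
  above-unique j = filter⁺ (above? j) (allFin⁺ L)

  rank-< : ∀ {i j} → f i ≡ f j → R i j → rank j < rank i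
  rank-< {i} {j} fi≡fj Rij = Unique-⊆-length
    (¬Any⇒All¬ _ (R-irrefl ∘ proj₂ ∘ above-∈) ∷ above-unique j)
    λ { (here refl) → ∈-above (fi≡fj , Rij)
      ; (there k∈) → let (fj≡fk , Rjk) = above-∈ k∈ in
                     ∈-above (trans fi≡fj fj≡fk , R-trans Rij Rjk) }

  rank-injective : ∀ {i j} → f i ≡ f j → rank i ≡ rank j → i ≡ j
  rank-injective {i} {j} fi≡fj eq with i Finₚ.≟ j
  ... | yes i≡j = i≡j
  ... | no i≢j with R-total i≢j fi≡fj
  ... | inj₁ Rij = contradiction (sym eq) (<⇒≢ (rank-< fi≡fj Rij))
  ... | inj₂ Rji = contradiction eq (<⇒≢ (rank-< (sym fi≡fj) Rji))

  -- Fibre and rank together determine an element, and ranks below `κ` allow `m * κ` combinations.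
  low-rank≤ : ∀ κ → length (filter (λ j → rank j ℕ.<? κ) (allFin L)) ≤ m * κ
  low-rank≤ κ = Finₚ.injective⇒≤ {f = code} code-injective
    where
    low : List (Fin L)
    low = filter (λ j → rank j ℕ.<? κ) (allFin L)
    rank<κ : ∀ x → rank (lookup low x) < κ
    rank<κ x = proj₂ (∈-filter⁻ (λ j → rank j ℕ.<? κ) {xs = allFin L} (∈-lookup {xs = low} x))
    code : Fin (length low) → Fin (m * κ)
    code x = combine (f (lookup low x)) (fromℕ< (rank<κ x))
    code-injective : ∀ {x y} → code x ≡ code y → x ≡ y
    code-injective {x} {y} eq with Finₚ.combine-injective (f (lookup low x)) _ (f (lookup low y)) _ eq
    ... | f≡ , r≡ = lookup-injective (filter⁺ (λ j → rank j ℕ.<? κ) (allFin⁺ L)) x y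
      (rank-injective f≡ (Finₚ.fromℕ<-injective _ _ (rank<κ x) (rank<κ y) r≡))

<-total : {L : ℕ} {i j : Fin L} → i ≢ j → i Fin.< j ⊎ j Fin.< i
<-total {i = i} {j} i≢j with Finₚ.<-cmp i j
... | tri< i<j _ _ = inj₁ i<j
... | tri≈ _ i≡j _ = contradiction i≡j i≢j
... | tri> _ _ j<i = inj₂ j<i

injective₃⇒≤ : {a b c m : ℕ} (f : Fin a → Fin b → Fin c → Fin m) →
               (∀ {x y z x′ y′ z′} → f x y z ≡ f x′ y′ z′ → x ≡ x′ × y ≡ y′ × z ≡ z′) →
               a * (b * c) ≤ m
injective₃⇒≤ {a} {b} {c} {m} f f-inj = Finₚ.injective⇒≤ {f = g} g-injective
  where
  g : Fin (a * (b * c)) → Fin m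
  g w = f (proj₁ (remQuot {a} (b * c) w))
          (proj₁ (remQuot {b} c (proj₂ (remQuot {a} (b * c) w))))
          (proj₂ (remQuot {b} c (proj₂ (remQuot {a} (b * c) w))))
  remQuot-injective : ∀ {k} l {w w′ : Fin (k * l)} →
    proj₁ (remQuot {k} l w) ≡ proj₁ (remQuot {k} l w′) →
    proj₂ (remQuot {k} l w) ≡ proj₂ (remQuot {k} l w′) → w ≡ w′
  remQuot-injective {k} l {w} {w′} eq₁ eq₂ =
    trans (sym (Finₚ.combine-remQuot {k} l w))
          (trans (cong₂ combine eq₁ eq₂) (Finₚ.combine-remQuot {k} l w′))
  g-injective : ∀ {w w′} → g w ≡ g w′ → w ≡ w′
  g-injective {w} {w′} eq with f-inj eq
  ... | x≡ , y≡ , z≡ = remQuot-injective {a} (b * c) x≡ (remQuot-injective {b} c y≡ z≡)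

module DoubleRank {L n p : ℕ} (c : Fin L → Fin n) (q : Fin L → Fin p)
  {_⊏_ : Fin L → Fin L → Set} (_⊏?_ : B.Decidable _⊏_)
  (⊏-irrefl : ∀ {i} → ¬ i ⊏ i)
  (⊏-trans : ∀ {i j k} → i ⊏ j → j ⊏ k → i ⊏ k)
  (⊏-total : ∀ {i j} → i ≢ j → q i ≡ q j → i ⊏ j ⊎ j ⊏ i)
  (determined : ∀ {i j k i′ j′ k′} →
    i ≢ j × c i ≡ c j × q j ≡ q k × j ⊏ k →
    i′ ≢ j′ × c i′ ≡ c j′ × q j′ ≡ q k′ × j′ ⊏ k′ →
    q i ≡ q i′ → c k ≡ c k′ → i ≡ i′ × j ≡ j′ × k ≡ k′)
  where

  -- Inside a tail class any linear order serves to count edges, so that of the indices is taken.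
  module C = Rank c Finₚ._<?_ (Finₚ.<-irrefl refl) Finₚ.<-trans (λ i≢j _ → <-total i≢j)
  module Q = Rank q _⊏?_ ⊏-irrefl ⊏-trans ⊏-total

  C-high : ℕ → List (Fin L)
  C-high δ = filter (λ j → δ ℕ.≤? C.rank j) (allFin L)

  high : ℕ → ℕ → List (Fin L)
  high δ κ = filter (λ j → κ ℕ.≤? Q.rank j) (C-high δ)

  high-unique : ∀ δ κ → Unique (high δ κ)
  high-unique δ κ =
    filter⁺ (λ j → κ ℕ.≤? Q.rank j) (filter⁺ (λ j → δ ℕ.≤? C.rank j) (allFin⁺ L))

  -- `low-rank≤` bounds the edges of low rank in their class and those of low rank along their pair;
  -- `high δ κ` is what remains.
  size≤ : ∀ δ κ → L ≤ n * δ + (p * κ + length (high δ κ))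
  size≤ δ κ = begin
    L
      ≡⟨ length-tabulate {n = L} id ⟨
    length (allFin L)
      ≤⟨ length≤filter+filter (λ j → C.rank j ℕ.<? δ) (λ j → δ ℕ.≤? C.rank j)
           (λ j → ℕₚ.<-≤-connex (C.rank j) δ) (allFin L) ⟩
    length (filter (λ j → C.rank j ℕ.<? δ) (allFin L)) + length (C-high δ)
      ≤⟨ ℕₚ.+-mono-≤ (C.low-rank≤ δ)
           (length≤filter+filter (λ j → Q.rank j ℕ.<? κ) (λ j → κ ℕ.≤? Q.rank j)
             (λ j → ℕₚ.<-≤-connex (Q.rank j) κ) (C-high δ)) ⟩
    n * δ + (length (filter (λ j → Q.rank j ℕ.<? κ) (C-high δ)) + length (high δ κ))
      ≤⟨ ℕₚ.+-monoʳ-≤ (n * δ) (ℕₚ.+-monoˡ-≤ _ (≤-trans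
           (Unique-⊆-length
             (filter⁺ (λ j → Q.rank j ℕ.<? κ) (filter⁺ (λ j → δ ℕ.≤? C.rank j) (allFin⁺ L)))
             λ j∈ → ∈-filter⁺ (λ j → Q.rank j ℕ.<? κ) (∈-allFin _)
               (proj₂ (∈-filter⁻ (λ j → Q.rank j ℕ.<? κ) {xs = C-high δ} j∈)))
           (Q.low-rank≤ κ))) ⟩
    n * δ + (p * κ + length (high δ κ))
      ∎
    where open ℕₚ.≤-Reasoning

  -- Each `j` in `high δ κ` has `δ` further edges `i` in its class and `κ` later edges `k` along its
  -- pair. By `determined`, the pair of `i` and the class of `k` encode the triple injectively.
  high*δ*κ≤ : ∀ δ κ → length (high δ κ) * (δ * κ) ≤ p * n
  high*δ*κ≤ δ κ = injective₃⇒≤ code code-injective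
    where
    H : List (Fin L)
    H = high δ κ
    δ≤ : ∀ x → δ ≤ C.rank (lookup H x)
    δ≤ x = proj₂ (∈-filter⁻ (λ j → δ ℕ.≤? C.rank j) {xs = allFin L}
      (proj₁ (∈-filter⁻ (λ j → κ ℕ.≤? Q.rank j) {xs = C-high δ} (∈-lookup {xs = H} x))))
    κ≤ : ∀ x → κ ≤ Q.rank (lookup H x)
    κ≤ x = proj₂ (∈-filter⁻ (λ j → κ ℕ.≤? Q.rank j) {xs = C-high δ} (∈-lookup {xs = H} x))
    i : Fin (length H) → Fin δ → Fin L
    i x y = lookup (C.above (lookup H x)) (inject≤ y (δ≤ x))
    k : Fin (length H) → Fin κ → Fin L
    k x z = lookup (Q.above (lookup H x)) (inject≤ z (κ≤ x))
    code : Fin (length H) → Fin δ → Fin κ → Fin (p * n)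
    code x y z = combine (q (i x y)) (c (k x z))
    valid : ∀ x y z → let j = lookup H x in
            i x y ≢ j × c (i x y) ≡ c j × q j ≡ q (k x z) × j ⊏ k x z
    valid x y z with C.above-∈ (∈-lookup {xs = C.above (lookup H x)} (inject≤ y (δ≤ x)))
                   | Q.above-∈ (∈-lookup {xs = Q.above (lookup H x)} (inject≤ z (κ≤ x)))
    ... | cj≡ci , j<i | qj≡qk , j⊏k =
      (λ i≡j → Finₚ.<-irrefl (sym i≡j) j<i) , sym cj≡ci , qj≡qk , j⊏k
    code-injective : ∀ {x y z x′ y′ z′} → code x y z ≡ code x′ y′ z′ →
                     x ≡ x′ × y ≡ y′ × z ≡ z′
    code-injective {x} {y} {z} {x′} {y′} {z′} eq
      with Finₚ.combine-injective (q (i x y)) _ (q (i x′ y′)) _ eq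
    ... | q≡ , c≡ with determined (valid x y z) (valid x′ y′ z′) q≡ c≡
    ... | i≡ , j≡ , k≡ with lookup-injective (high-unique δ κ) x x′ j≡
    ... | refl =
      refl ,
      Finₚ.inject≤-injective (δ≤ x) (δ≤ x) y y′ (lookup-injective (C.above-unique (lookup H x)) _ _ i≡) ,
      Finₚ.inject≤-injective (κ≤ x) (κ≤ x) z z′ (lookup-injective (Q.above-unique (lookup H x)) _ _ k≡)

-- Arithmetic of the final bound

-- `κ` is `L / (4 * m)` rounded down. It is at least 1 because `4 * m ≤ L`, so rounding costs at
-- most a factor 2.
quarter : ∀ m L → 0 < m → 4 * m ≤ L → ∃[ κ ] (4 * (m * κ) ≤ L × L ≤ 8 * (m * κ))
quarter (suc m) L _ 4m≤L = κ , lower , upper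
  where
  M κ : ℕ
  M = 4 * suc m
  κ = L / M
  assoc : ∀ m κ → 4 * (m * κ) ≡ κ * (4 * m)
  assoc = solve-∀
  double : ∀ m κ → κ * (4 * m) + κ * (4 * m) ≡ 8 * (m * κ)
  double = solve-∀
  open ℕₚ.≤-Reasoning
  lower : 4 * (suc m * κ) ≤ L
  lower = ≤-trans (≤-reflexive (assoc (suc m) κ)) (m/n*n≤m L M)
  upper : L ≤ 8 * (suc m * κ)
  upper = begin
    L                 ≡⟨ m≡m%n+[m/n]*n L M ⟩
    L % M + κ * M     ≤⟨ ℕₚ.+-monoˡ-≤ (κ * M) (ℕₚ.<⇒≤ (m%n<n L M)) ⟩
    M + κ * M         ≡⟨ cong (_+ κ * M) (ℕₚ.*-identityˡ M) ⟨
    1 * M + κ * M     ≤⟨ ℕₚ.+-monoˡ-≤ (κ * M) (ℕₚ.*-monoˡ-≤ M (m≥n⇒m/n>0 4m≤L)) ⟩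
    κ * M + κ * M     ≡⟨ double (suc m) κ ⟩
    8 * (suc m * κ)   ∎

-- Each discarded part has at most `L / 4` edges, hence `L ≤ 2 * g`. Multiplying this by both upper
-- bounds on `L` produces the factor `g * (δ * κ)`, and 128 is `2 * 8 * 8`.
cube-bound : ∀ n p L g δ κ →
  4 * (n * δ) ≤ L → L ≤ 8 * (n * δ) → 4 * (p * κ) ≤ L → L ≤ 8 * (p * κ) →
  L ≤ n * δ + (p * κ + g) → g * (δ * κ) ≤ p * n → L ^ 3 ≤ 128 * (n * p) ^ 2
cube-bound n p L g δ κ lo₁ hi₁ lo₂ hi₂ size few = begin
  L ^ 3                                       ≡⟨ cong (λ x → L * (L * x)) (ℕₚ.*-identityʳ L) ⟩
  L * (L * L)                                 ≤⟨ ℕₚ.*-mono-≤ L≤2g (ℕₚ.*-mono-≤ hi₁ hi₂) ⟩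
  2 * g * (8 * (n * δ) * (8 * (p * κ)))       ≡⟨ regroup n p g δ κ 2 8 8 ⟩
  128 * (n * p) * (g * (δ * κ))               ≤⟨ ℕₚ.*-monoʳ-≤ (128 * (n * p)) few ⟩
  128 * (n * p) * (p * n)                     ≡⟨ square 128 n p ⟩
  128 * (n * p) ^ 2                           ∎
  where
  open ℕₚ.≤-Reasoning
  regroup : ∀ n p g δ κ x y z →
    x * g * (y * (n * δ) * (z * (p * κ))) ≡ x * y * z * (n * p) * (g * (δ * κ))
  regroup = solve-∀
  square : ∀ x n p → x * (n * p) * (p * n) ≡ x * (n * p * (n * p * 1))
  square = solve-∀
  spread : ∀ a b g → 4 * (a + (b + g)) ≡ 4 * a + (4 * b + 4 * g)
  spread = solve-∀
  four : ∀ L → 4 * L ≡ L + (L + 2 * L)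
  four = solve-∀
  four′ : ∀ g → 4 * g ≡ 2 * (2 * g)
  four′ = solve-∀
  L≤2g : L ≤ 2 * g
  L≤2g = ℕₚ.*-cancelˡ-≤ 2 (ℕₚ.+-cancelˡ-≤ L _ _ (ℕₚ.+-cancelˡ-≤ L _ _ (begin
    L + (L + 2 * L)                 ≡⟨ four L ⟨
    4 * L                           ≤⟨ ℕₚ.*-monoʳ-≤ 4 size ⟩
    4 * (n * δ + (p * κ + g))       ≡⟨ spread (n * δ) (p * κ) g ⟩
    4 * (n * δ) + (4 * (p * κ) + 4 * g)
      ≤⟨ ℕₚ.+-mono-≤ lo₁ (ℕₚ.+-monoˡ-≤ (4 * g) lo₂) ⟩
    L + (L + 4 * g)                 ≡⟨ cong (λ x → L + (L + x)) (four′ g) ⟩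
    L + (L + 2 * (2 * g))           ∎)))

cube-mono : ∀ {a b} → a ≤ b → a ^ 3 ≤ b ^ 3
cube-mono = ℕₚ.^-monoˡ-≤ 3

-- If `L < 4 * n`, the term `n ^ 3` suffices. If `L < 4 * p`, then `p ≤ n * n` turns `p ^ 3` into at
-- most `(n * p) ^ 2`. Otherwise `δ` and `κ` can be chosen positive by `quarter`.
edges-bound : ∀ n p L → p ≤ n * n → (h : ℕ → ℕ → ℕ) →
  (∀ δ κ → L ≤ n * δ + (p * κ + h δ κ)) → (∀ δ κ → h δ κ * (δ * κ) ≤ p * n) →
  L ^ 3 ≤ 128 * (n ^ 3 + (n * p) ^ 2)
edges-bound n p L p≤n² h size few =
  [ few-vertices ∘ ℕₚ.<⇒≤
  , (λ 4n≤L → [ few-pairs ∘ ℕₚ.<⇒≤ , many n p p≤n² size few 4n≤L ]′ (ℕₚ.<-≤-connex L (4 * p)))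
  ]′ (ℕₚ.<-≤-connex L (4 * n))
  where
  open ℕₚ.≤-Reasoning
  few-vertices : L ≤ 4 * n → L ^ 3 ≤ 128 * (n ^ 3 + (n * p) ^ 2)
  few-vertices L≤4n = begin
    L ^ 3                          ≤⟨ cube-mono L≤4n ⟩
    (4 * n) ^ 3                    ≡⟨ expand 4 n ⟩
    64 * n ^ 3                     ≤⟨ ℕₚ.*-mono-≤ (ℕₚ.m≤m+n 64 64) (ℕₚ.m≤m+n (n ^ 3) ((n * p) ^ 2)) ⟩
    128 * (n ^ 3 + (n * p) ^ 2)    ∎
    where
    expand : ∀ x n → (x * n) * ((x * n) * ((x * n) * 1)) ≡ x * x * x * (n * (n * (n * 1)))
    expand = solve-∀
  few-pairs : L ≤ 4 * p → L ^ 3 ≤ 128 * (n ^ 3 + (n * p) ^ 2)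
  few-pairs L≤4p = begin
    L ^ 3                          ≤⟨ cube-mono L≤4p ⟩
    (4 * p) ^ 3                    ≡⟨ expand 4 p ⟩
    64 * (p * p * p)               ≤⟨ ℕₚ.*-monoʳ-≤ 64 (ℕₚ.*-monoʳ-≤ (p * p) p≤n²) ⟩
    64 * (p * p * (n * n))         ≡⟨ cong (64 *_) (square n p) ⟩
    64 * (n * p) ^ 2               ≤⟨ ℕₚ.*-mono-≤ (ℕₚ.m≤m+n 64 64) (ℕₚ.m≤n+m ((n * p) ^ 2) (n ^ 3)) ⟩
    128 * (n ^ 3 + (n * p) ^ 2)    ∎
    where
    expand : ∀ x p → (x * p) * ((x * p) * ((x * p) * 1)) ≡ x * x * x * (p * p * p)
    expand = solve-∀
    square : ∀ n p → p * p * (n * n) ≡ n * p * (n * p * 1)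
    square = solve-∀
  -- The case `p = 0`, where `quarter` cannot supply `κ`: at `δ = κ = 1` the bound `few` forces
  -- `h 1 1` to vanish.
  L≤n+0 : ∀ n → (∀ δ κ → L ≤ n * δ + (0 * κ + h δ κ)) → (∀ δ κ → h δ κ * (δ * κ) ≤ 0 * n) → L ≤ n
  L≤n+0 n size few = begin
    L                            ≤⟨ size 1 1 ⟩
    n * 1 + h 1 1                ≡⟨ cong₂ _+_ (ℕₚ.*-identityʳ n) (sym (ℕₚ.*-identityʳ (h 1 1))) ⟩
    n + h 1 1 * 1                ≤⟨ ℕₚ.+-monoʳ-≤ n (few 1 1) ⟩
    n + 0                        ≡⟨ ℕₚ.+-identityʳ n ⟩
    n                            ∎
  positive : ∀ n p → 0 < n → 0 < p →
    (∀ δ κ → L ≤ n * δ + (p * κ + h δ κ)) → (∀ δ κ → h δ κ * (δ * κ) ≤ p * n) →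
    4 * n ≤ L → 4 * p ≤ L → L ^ 3 ≤ 128 * (n ^ 3 + (n * p) ^ 2)
  positive n p 0<n 0<p size few 4n≤L 4p≤L =
    let (δ , lo₁ , hi₁) = quarter n L 0<n 4n≤L
        (κ , lo₂ , hi₂) = quarter p L 0<p 4p≤L
    in ≤-trans (cube-bound n p L (h δ κ) δ κ lo₁ hi₁ lo₂ hi₂ (size δ κ) (few δ κ))
               (ℕₚ.*-monoʳ-≤ 128 (ℕₚ.m≤n+m ((n * p) ^ 2) (n ^ 3)))
  many : ∀ n p → p ≤ n * n →
    (∀ δ κ → L ≤ n * δ + (p * κ + h δ κ)) → (∀ δ κ → h δ κ * (δ * κ) ≤ p * n) →
    4 * n ≤ L → 4 * p ≤ L → L ^ 3 ≤ 128 * (n ^ 3 + (n * p) ^ 2)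
  many n zero _ size few _ _ = ≤-trans (cube-mono (L≤n+0 n size few))
    (≤-trans (ℕₚ.m≤m+n (n ^ 3) ((n * 0) ^ 2)) (ℕₚ.m≤n*m (n ^ 3 + (n * 0) ^ 2) 128))
  -- No vertices but some pair would contradict `p ≤ n * n`.
  many (suc n) (suc p) _ = positive (suc n) (suc p) (s≤s z≤n) (s≤s z≤n)

cube-double : ∀ b → (b + b) ^ 3 ≡ 8 * b ^ 3
cube-double = cube
  where
  cube : ∀ b → (b + b) * ((b + b) * ((b + b) * 1)) ≡ 8 * (b * (b * (b * 1)))
  cube = solve-∀

-- The sum is at most twice the larger term.
cube-+ : ∀ a b → (a + b) ^ 3 ≤ 8 * (a ^ 3 + b ^ 3)
cube-+ a b with ℕₚ.≤-total a b
... | inj₁ a≤b = begin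
  (a + b) ^ 3            ≤⟨ cube-mono (ℕₚ.+-monoˡ-≤ b a≤b) ⟩
  (b + b) ^ 3            ≡⟨ cube-double b ⟩
  8 * b ^ 3              ≤⟨ ℕₚ.*-monoʳ-≤ 8 (ℕₚ.m≤n+m (b ^ 3) (a ^ 3)) ⟩
  8 * (a ^ 3 + b ^ 3)    ∎
  where
  open ℕₚ.≤-Reasoning
... | inj₂ b≤a = begin
  (a + b) ^ 3            ≤⟨ cube-mono (ℕₚ.+-monoʳ-≤ a b≤a) ⟩
  (a + a) ^ 3            ≡⟨ cube-double a ⟩
  8 * a ^ 3              ≤⟨ ℕₚ.*-monoʳ-≤ 8 (ℕₚ.m≤m+n (a ^ 3) (b ^ 3)) ⟩
  8 * (a ^ 3 + b ^ 3)    ∎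
  where
  open ℕₚ.≤-Reasoning

total-bound : ∀ n p L t → L ^ 3 ≤ 128 * (n ^ 3 + (n * p) ^ 2) → t ≤ n + n →
              (L + t) ^ 3 ≤ 1088 * (n ^ 3 + (n * p) ^ 2)
total-bound n p L t L³≤ t≤ = begin
  (L + t) ^ 3                       ≤⟨ cube-+ L t ⟩
  8 * (L ^ 3 + t ^ 3)               ≤⟨ ℕₚ.*-monoʳ-≤ 8 (ℕₚ.+-mono-≤ L³≤ t³≤) ⟩
  8 * (128 * X + 8 * X)             ≡⟨ collect 8 128 8 X ⟩
  1088 * X                          ∎
  where
  open ℕₚ.≤-Reasoning
  X : ℕ
  X = n ^ 3 + (n * p) ^ 2
  collect : ∀ x y z X → x * (y * X + z * X) ≡ x * (y + z) * X
  collect = solve-∀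
  t³≤ : t ^ 3 ≤ 8 * X
  t³≤ = begin
    t ^ 3          ≤⟨ cube-mono t≤ ⟩
    (n + n) ^ 3    ≡⟨ cube-double n ⟩
    8 * n ^ 3      ≤⟨ ℕₚ.*-monoʳ-≤ 8 (ℕₚ.m≤m+n (n ^ 3) _) ⟩
    8 * X          ∎

-- Assembly of the preserver and the edge bound

sparse-preserver : ∀ {n} (E : Graph n) (P : List (Edge n)) →
  ∃[ F ] ∃[ T ] ∃[ h ]
    (IsReachabilityPreserver E P (F ++ T) × length T ≤ n + n ×
     (∀ δ κ → length F ≤ n * δ + (length P * κ + h δ κ)) ×
     (∀ δ κ → h δ κ * (δ * κ) ≤ length P * n))
sparse-preserver E P with StrongComponents.skeleton E
... | T , T⊆E , T≤2n , connect
  -- Repeated edges are removed first, so that distinct positions in `F` are distinct edges; every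
  -- remaining edge is tried for deletion.
  with Pruning.prune E P T (deduplicate _≟ᵉ_ E) (deduplicate _≟ᵉ_ E)
         (DecUnique.deduplicate-! _≟ᵉ_ E)
         (All.tabulate λ _ → Reach-mono (∈-++⁺ˡ ∘ ∈-deduplicate⁺ _≟ᵉ_))
... | F , F⊆ , uF , keep , essential =
  F , T , (λ δ κ → length (Count.high δ κ)) ,
  (G⊆E , λ st∈P → mk⇔ (Reach-mono G⊆E) (All.lookup keep st∈P)) ,
  T≤2n , Count.size≤ , Count.high*δ*κ≤
  where
  G⊆E : Subgraph (F ++ T) E
  G⊆E e with ∈-++⁻ F e
  ... | inj₁ e∈F = ∈-deduplicate⁻ _≟ᵉ_ E (F⊆ e∈F)
  ... | inj₂ e∈T = T⊆E e∈T
  module SCC = StrongComponents E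
  module Ess = EssentialEdges E P T F SCC.rep connect
    -- Mutual reachability in `F ++ T` implies it in `E`, so both vertices have the same
    -- representative and `T` links them.
    (λ p r → connect (SCC.rep-cong (Reach-mono G⊆E p , Reach-mono G⊆E r)))
    uF (λ e∈F → essential (F⊆ e∈F) e∈F)
  module Count = DoubleRank Ess.c Ess.q Ess._⊏?_ (Ess.no-return _)
    (λ {i} {j} {k} → Ess.⊏-trans {i} {j} {k}) Ess.⊏-total Ess.triple-injective

-- The bound is cubed to stay in ℕ: the cube of `n + (n * p)^(2/3)` agrees with
-- `n ^ 3 + (n * p) ^ 2` up to a constant factor. `Unique P` makes `length P` the cardinality of the
-- set of pairs.
theorem9 : ∃[ C ] ((n : ℕ) (E : Graph n) (P : List (Fin n × Fin n)) → Unique P →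
    ∃[ E′ ] (IsReachabilityPreserver E P E′ ×
    length E′ ^ 3 ≤ C * (n ^ 3 + (n * length P) ^ 2)))
-- The constant is `8 * (128 + 8)`: 128 from `F`, 8 from the at most `2n` edges of `T`, and the
-- outer 8 from cubing their sum.
theorem9 = 1088 , λ n E P uP →
  let (F , T , h , preserves , T≤2n , size , few) = sparse-preserver E P
      F-bound = edges-bound n (length P) (length F) (Unique⇒length≤n*n uP) h size few
  in F ++ T , preserves ,
     ≤-trans (≤-reflexive (cong (_^ 3) (length-++ F)))
             (total-bound n (length P) (length F) (length T) F-bound T≤2n)
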